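{- Let $n \ge 4$, and let $\mathrm{st}_{\le n}$ be a weakly bicompatible permutation statistic defined on permutations of length at most $n$ whose restriction $\mathrm{st}_{\le n-1}$ to permutations of length at most $n-1$ is trivial. (i) If $n = p^k$ for some prime $p$ and some $k \ge 1$, then the restriction $\mathrm{st}_n$ of the statistic to permutations of length $n$ has at most $p$ equivalence classes. (ii) Otherwise (i.e. if $n$ is not a power of a prime), $\mathrm{st}_n$ is trivial.
   Context: A permutation is a finite (possibly empty) sequence $\pi = \pi_1 \cdots \pi_n$ of distinct positive integers, called its letters; $|\pi| = n$ is its length. Permutations $\pi,\sigma$ of the same length have the same relative order if $\pi_i<\pi_j \iff \sigma_i<\sigma_j$ for all $i,j$. A permutation statistic defined on length $\le n$ is a function $\mathrm{st}_{\le n}$ on the permutations of length at most $n$ that takes equal values on permutations with the same relative order. Write $\pi \sim_{\mathrm{st}} \sigma$ if $|\pi| = |\sigma|$ and $\mathrm{st}(\pi) = \mathrm{st}(\sigma)$; the equivalence classes of a statistic on length $n$ are those of $\sim_{\mathrm{st}}$ on permutations of length $n$. A statistic (on given lengths) is trivial if $\pi\sim_{\mathrm{st}}\sigma$ for all $\pi,\sigma$ of equal length in its domain. Permutations $\pi,\sigma$ are disjoint if they have no letters in common; then the shuffle set $\pi ⧢ \sigma$ is the set of all $\binom{|\pi|+|\sigma|}{|\pi|}$ permutations of length $|\pi|+|\sigma|$ containing both $\pi$ and $\sigma$ as subsequences. Write $\pi < \sigma$ if every letter of $\pi$ is strictly less than every letter of $\sigma$. A statistic is weakly shuffle-compatible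 if whenever $\pi < \sigma$, the multiset $\{\mathrm{st}(\tau) : \tau \in \pi ⧢ \sigma\}$ depends only on $\mathrm{st}(\pi), \mathrm{st}(\sigma), |\pi|, |\sigma|$. It is substring-compatible if $\pi \sim_{\mathrm{st}} \sigma$ implies $\pi_i \cdots \pi_j \sim_{\mathrm{st}} \sigma_i \cdots \sigma_j$ for all $1 \le i \le j \le |\pi|$. It is weakly bicompatible if it is weakly shuffle-compatible and substring-compatible. For a statistic defined on length $\le n$, these conditions are imposed only when all permutations involved have length at most $n$. -}

module Defs where

open import Level using (Level)
open import Data.Nat.Base using (ℕ; suc; _+_; _^_; _≤_; _<_)
open import Data.Nat.Properties using (≤-trans)
open import Data.Nat.Primality using (Prime)
open import Data.Fin.Base using (Fin)
open import Data.Vec.Base using (Vec; lookup; take; drop; toList)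
open import Data.Vec.Relation.Unary.All using (All)
import Data.Vec.Relation.Unary.All.Properties as All
open import Data.Vec.Relation.Unary.Unique.Propositional using (Unique)
import Data.Vec.Relation.Unary.Unique.Propositional.Properties as Unique
open import Data.List.Base using (List; length; map)
open import Data.List.Relation.Unary.Any using (Any)
import Data.List.Relation.Unary.Unique.Propositional as List
open import Data.List.Membership.Propositional using (_∈_)
open import Data.List.Relation.Binary.Sublist.Propositional using (_⊆_)
open import Data.List.Relation.Binary.Permutation.Propositional using (_↭_)
open import Data.Product.Base using (_×_; ∃-syntax)
open import Function.Bundles using (_⇔_)
open import Relation.Binary.PropositionalEquality.Core using (_≡_)

private
  variable
    a : Level
    A : Set a
    k l m n : ℕ

-- The side conditions are irrelevant, so π ≡ σ holds exactly when the
-- letter sequences agree.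
record Perm (m : ℕ) : Set where
  constructor mkPerm
  field
    letters   : Vec ℕ m
    .positive : All (0 <_) letters
    .distinct : Unique letters

open Perm public

_!_ : Perm m → Fin m → ℕ
π ! i = lookup (letters π) i

SameRelativeOrder : Perm m → Perm m → Set
SameRelativeOrder π σ = ∀ i j → (π ! i < π ! j) ⇔ (σ ! i < σ ! j)

-- For π of length i + (l + r), the substring π_{i+1} ⋯ π_{i+l}.
substring : ∀ i l {r} → Perm (i + (l + r)) → Perm l
substring i l (mkPerm xs pos dis) = mkPerm
  (take l (drop i xs))
  (All.take⁺ l (All.drop⁺ i pos))
  (Unique.take⁺ l (Unique.drop⁺ i dis))

_≪_ : Perm k → Perm l → Set
π ≪ σ = ∀ i j → π ! i < σ ! j

-- Used only when π ≪ σ, in which case π and σ are disjoint.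
_∈_⧢_ : Perm (k + l) → Perm k → Perm l → Set
τ ∈ π ⧢ σ = (toList (letters π) ⊆ toList (letters τ))
          × (toList (letters σ) ⊆ toList (letters τ))

-- ts lists each element of the finite set π ⧢ σ exactly once.
record _Enumerates_⧢_ (ts : List (Perm (k + l))) (π : Perm k) (σ : Perm l) : Set where
  field
    once    : List.Unique ts
    members : ∀ τ → (τ ∈ ts) ⇔ (τ ∈ π ⧢ σ)

record Statistic (A : Set a) (n : ℕ) : Set a where
  field
    value    : .(m ≤ n) → Perm m → A
    respects : .(m≤n : m ≤ n) (π σ : Perm m) →
               SameRelativeOrder π σ → value m≤n π ≡ value m≤n σ

open Statistic public

restrict : .(m ≤ n) → Statistic A n → Statistic A m
restrict m≤n st = record
  { value    = λ l≤m → value st (≤-trans l≤m m≤n)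
  ; respects = λ l≤m → respects st (≤-trans l≤m m≤n)
  }

Equivalent : (st : Statistic {a} A n) → .(m ≤ n) → Perm m → Perm m → Set a
Equivalent st m≤n π σ = value st m≤n π ≡ value st m≤n σ

TrivialOn : (m : ℕ) → .(m ≤ n) → Statistic {a} A n → Set a
TrivialOn m m≤n st = (π σ : Perm m) → Equivalent st m≤n π σ

Trivial : Statistic {a} A n → Set a
Trivial {n = n} st = ∀ m (m≤n : m ≤ n) → TrivialOn m m≤n st

-- The permutations of length m are covered by the classes of at most c
-- representatives (which may be equivalent to one another).
AtMostClassesOn : (m : ℕ) → .(m ≤ n) → Statistic {a} A n → ℕ → Set a
AtMostClassesOn m m≤n st c =
  ∃[ reps ] (length reps ≤ c) × ((π : Perm m) → Any (Equivalent st m≤n π) reps)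

-- Multisets of values are lists up to _↭_.
WeaklyShuffleCompatible : Statistic {a} A n → Set a
WeaklyShuffleCompatible {n = n} st =
  ∀ {k l} (k≤n : k ≤ n) (l≤n : l ≤ n) (k+l≤n : k + l ≤ n)
  (π π′ : Perm k) (σ σ′ : Perm l) → π ≪ σ → π′ ≪ σ′ →
  value st k≤n π ≡ value st k≤n π′ → value st l≤n σ ≡ value st l≤n σ′ →
  ∀ ts ts′ → ts Enumerates π ⧢ σ → ts′ Enumerates π′ ⧢ σ′ →
  map (value st k+l≤n) ts ↭ map (value st k+l≤n) ts′

SubstringCompatible : Statistic {a} A n → Set a
SubstringCompatible {n = n} st =
  ∀ i l r (m≤n : i + (suc l + r) ≤ n) (l≤n : suc l ≤ n)
  (π σ : Perm (i + (suc l + r))) → Equivalent st m≤n π σ →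
  Equivalent st l≤n (substring i (suc l) π) (substring i (suc l) σ)

WeaklyBicompatible : Statistic {a} A n → Set a
WeaklyBicompatible st = WeaklyShuffleCompatible st × SubstringCompatible st

PrimePower : ℕ → Set
PrimePower n = ∃[ p ] ∃[ k ] Prime p × 1 ≤ k × n ≡ p ^ k

{-# OPTIONS --safe #-}
-- Since st is trivial below length n, the multiset of values on π ⧢ σ depends only on |π| and |σ|.
-- Let μ be the multiplicity of a class in [1] ⧢ [2 … n], and ν that in [1 … k] ⧢ [k+1 … n].
-- Counting the class in [1] ⧢ [2 … k] ⧢ [k+1 … n] in two ways gives C (n − 1, k − 1) μ = k ν.
-- If k = p ^ e < n divides n, then p does not divide C (n − 1, k − 1), so k divides μ.
-- Every value occurs among the n shuffles in [1] ⧢ [2 … n], because a permutation is a shuffle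
-- of its least letter with its other letters. If n = p ^ k, every class therefore takes at least
-- p ^ (k − 1) of these n shuffles; if n is not a prime power, n divides μ and there is one class.
module Submission where

open import Defs
open import Data.Bool.Base using (if_then_else_)
open import Data.List.Base using (List; []; _∷_; _++_; length; map; filter; [_]; mapMaybe; concat; applyUpTo)
open import Data.List.Membership.Propositional using (_∈_)
open import Data.List.Membership.Propositional.Properties using (∈-filter⁺; ∈-filter⁻; ∈-map⁺; ∈-map⁻; ∈-++⁺ˡ; ∈-++⁺ʳ; ∈-++⁻; ∈-concat⁺′; ∈-concat⁻′; ∈-applyUpTo⁺; ∈-applyUpTo⁻)
open import Data.List.Properties using (map-++; map-∘; map-cong; length-map; length-++; ∷-injectiveˡ; ∷-injectiveʳ; length-applyUpTo; length-mapMaybe; ≡-dec)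
open import Data.List.Relation.Binary.Disjoint.Propositional using (Disjoint)
open import Data.List.Relation.Binary.Permutation.Propositional using (_↭_; ↭-refl; ↭-trans; ↭-reflexive; ↭-sym; prep; ↭⇒↭ₛ)
import Data.List.Relation.Binary.Permutation.Propositional.Properties as ↭
import Data.List.Relation.Binary.Permutation.Setoid.Properties as ↭ₛ
open import Data.List.Relation.Binary.Sublist.Propositional using (_⊆_; []; _∷_; _∷ʳ_; ⊆-refl; minimum)
open import Data.List.Relation.Binary.Sublist.Propositional.Properties using (++⁺)
open import Data.List.Relation.Unary.All as All using (All; []; _∷_; all?)
import Data.List.Relation.Unary.All.Properties as All
open import Data.List.Relation.Unary.AllPairs using ([]; _∷_; allPairs?)
open import Data.List.Relation.Unary.Any as Any using (here; there; Any)
import Data.List.Relation.Unary.Any.Properties as Any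
open import Data.List.Relation.Unary.Unique.Propositional using (Unique)
import Data.List.Relation.Unary.Unique.Propositional.Properties as Unique
open import Data.Maybe.Base as Maybe using (Maybe; just; nothing)
open import Data.Maybe.Properties using (just-injective)
import Data.Maybe.Relation.Unary.Any as MaybeAny
open import Data.Nat.Base using (ℕ; zero; suc; _+_; _*_; _∸_; _^_; _≤_; _<_; z≤n; s≤s; NonZero; nonTrivial⇒n>1; >-nonZero; ≢-nonZero⁻¹)
open import Data.Nat.Divisibility using (_∣_; divides; _∣?_; ∣-trans; m∣m*n; n∣m*n; 1∣_; ∣1⇒≡1; ∣⇒≤; *-monoʳ-∣; *-cancelˡ-∣; ∣m+n∣m⇒∣n; ∣n⇒∣m*n; ∣m⇒∣m*n)
open import Data.Nat.Induction using (<-rec; Acc; acc; <-wellFounded)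
open import Data.Nat.ListAction using (sum)
open import Data.Nat.ListAction.Properties using (sum-++; sum-↭)
open import Data.Nat.Primality using (Prime; euclidsLemma; ¬prime[1]; prime⇒nonZero; prime⇒nonTrivial)
open import Data.Nat.Primality.Factorisation using (factorise)
open import Data.Nat.Properties as ℕ using (≤-refl; pred[n]≤n)
open import Data.Nat.Tactic.RingSolver using (solve-∀)
open import Data.Product.Base using (_×_; _,_; ∃-syntax; proj₁; proj₂)
open import Data.Sum.Base using (inj₁; inj₂)
open import Data.Vec.Base using (Vec; []; _∷_; toList; fromList; cast)
open import Data.Vec.Properties using (toList-injective; toList-cast; toList∘fromList; length-toList; cast-is-id)
import Data.Vec.Relation.Unary.All as Vec
import Data.Vec.Relation.Unary.All.Properties as VecAll
import Data.Vec.Relation.Unary.Unique.Propositional as Vec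
open import Function.Base using (_∘_; id)
open import Function.Bundles using (mk⇔)
open import Level using (Level)
open import Relation.Binary.Definitions using (DecidableEquality; tri<; tri≈; tri>)
open import Relation.Binary.PropositionalEquality hiding ([_])
open import Relation.Nullary.Decidable using (Dec; yes; no; does; ¬?; _×-dec_; recompute)
open import Relation.Nullary.Negation using (¬_; contradiction)

private
  variable
    a b : Level
    A X : Set a
    B : Set b
    k l m n : ℕ
    w π ρ σ : List ℕ
    x y : X
    ws xs ys : List X

-- Arithmetic

-- By Euclid's lemma p divides m, say m = q * p. Cancelling one factor p leaves p ^ e dividing c *
-- q, and the exponent has dropped.
prime^∣-cancelˡ : ∀ {p c m} → Prime p → ¬ p ∣ c → ∀ e → p ^ e ∣ c * m → p ^ e ∣ m
prime^∣-cancelˡ p-prime p∤c zero _ = 1∣ _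
prime^∣-cancelˡ {p} {c} {m} p-prime p∤c (suc e) p^∣cm
  with euclidsLemma c m p-prime (∣-trans (m∣m*n (p ^ e)) p^∣cm)
... | inj₁ p∣c = contradiction p∣c p∤c
... | inj₂ (divides q refl) = subst (p * p ^ e ∣_) (ℕ.*-comm p q)
  (*-monoʳ-∣ p (prime^∣-cancelˡ p-prime p∤c e
    (*-cancelˡ-∣ p {{prime⇒nonZero p-prime}} (subst (p * p ^ e ∣_) (swap-factor c q p) p^∣cm))))
  where
  swap-factor : ∀ c q p → c * (q * p) ≡ p * (c * q)
  swap-factor = solve-∀

prime-part : ∀ {p} → Prime p → ∀ n → .{{NonZero n}} → ∃[ e ] ∃[ m ] n ≡ p ^ e * m × ¬ p ∣ m
prime-part {p} p-prime = <-rec (λ n → .{{NonZero n}} → _) step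
  where
  step : ∀ n → (∀ {k} → k < n → .{{NonZero k}} → ∃[ e ] ∃[ m ] k ≡ p ^ e * m × ¬ p ∣ m) →
         .{{NonZero n}} → ∃[ e ] ∃[ m ] n ≡ p ^ e * m × ¬ p ∣ m
  step n rec with p ∣? n
  ... | no p∤n = 0 , n , sym (ℕ.+-identityʳ n) , p∤n
  ... | yes (divides (suc k) refl)
    with e , m , k≡ , p∤m ← rec (ℕ.m<m*n (suc k) p (nonTrivial⇒n>1 p {{prime⇒nonTrivial p-prime}}))
    = suc e , m , trans (ℕ.*-comm (suc k) p) (trans (cong (p *_) k≡) (sym (ℕ.*-assoc p (p ^ e) m))) , p∤m

prime-divisor : ∀ n → 1 < n → ∃[ p ] Prime p × p ∣ n
prime-divisor n@(suc _) 1<n with factorise n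
... | record { factors = [] ; isFactorisation = refl } = contradiction 1<n (ℕ.<-irrefl refl)
... | record { factors = p ∷ ps ; isFactorisation = eq ; factorsPrime = p-prime ∷ _ } =
  p , p-prime , subst (p ∣_) (sym eq) (m∣m*n _)

-- Split off the full p-part of n, leaving a cofactor r prime to p. By strong induction r divides m,
-- say m = t * r; the p-part divides t * r and hence t.
prime-powers-∣⇒∣ : ∀ n {m} → .{{NonZero n}} →
  (∀ p e → Prime p → p ^ e ∣ n → p ^ e ∣ m) → n ∣ m
prime-powers-∣⇒∣ = <-rec _ step
  where
  step : ∀ n → (∀ {k} → k < n → ∀ {m} → .{{NonZero k}} →
           (∀ p e → Prime p → p ^ e ∣ k → p ^ e ∣ m) → k ∣ m) →
         ∀ {m} → .{{NonZero n}} → (∀ p e → Prime p → p ^ e ∣ n → p ^ e ∣ m) → n ∣ m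
  step 1 rec _ = 1∣ _
  step n@(suc (suc _)) rec powers∣m with prime-divisor n (s≤s (s≤s z≤n))
  ... | p , p-prime , p∣n with prime-part p-prime n
  -- p divides n, so its exponent is positive; n is nonzero, so the cofactor r is too.
  ...   | zero , r , n≡ , p∤r = contradiction (subst (p ∣_) (trans n≡ (ℕ.+-identityʳ r)) p∣n) p∤r
  ...   | suc e , zero , n≡ , _ with () ← trans n≡ (ℕ.*-zeroʳ (p ^ suc e))
  ...   | suc e , r@(suc _) , n≡ , p∤r = subst₂ _∣_ (sym n≡) refl q∣m
    where
    p^e>1 : 1 < p ^ suc e
    p^e>1 = ℕ.<-≤-trans (nonTrivial⇒n>1 p {{prime⇒nonTrivial p-prime}})
      (ℕ.m≤m*n p (p ^ e) {{ℕ.m^n≢0 p e {{prime⇒nonZero p-prime}}}})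

    r<n : r < n
    r<n = subst (r <_) (trans (ℕ.*-comm r _) (sym n≡)) (ℕ.m<m*n r _ p^e>1)

    r∣m : r ∣ _
    r∣m = rec r<n λ q f q-prime q^f∣r →
      powers∣m q f q-prime (subst (q ^ f ∣_) (sym n≡) (∣n⇒∣m*n (p ^ suc e) q^f∣r))

    q∣m : p ^ suc e * r ∣ _
    q∣m with divides t refl ← r∣m = subst (_∣ t * r) (ℕ.*-comm r _)
      (subst (r * p ^ suc e ∣_) (ℕ.*-comm r t) (*-monoʳ-∣ r
        (prime^∣-cancelˡ p-prime p∤r (suc e)
          (subst (p ^ suc e ∣_) (ℕ.*-comm t r)
            (powers∣m p (suc e) p-prime (subst (p ^ suc e ∣_) (sym n≡) (m∣m*n r)))))))

-- The binomial coefficient C (a + b) a.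
shuffleCount : ℕ → ℕ → ℕ
shuffleCount zero    b       = 1
shuffleCount (suc a) zero    = 1
shuffleCount (suc a) (suc b) = shuffleCount a (suc b) + shuffleCount (suc a) b

shuffleCount-1 : ∀ a → shuffleCount 1 a ≡ suc a
shuffleCount-1 zero    = refl
shuffleCount-1 (suc a) = cong suc (shuffleCount-1 a)

mutual
  -- Both absorption identities have the right side (a + b + 1) * C (a + b, a), so their left sides
  -- can be exchanged. After Pascal's rule this exchange turns both summands into multiples of one
  -- coefficient.
  shuffleCount-absorbˡ : ∀ a b → suc a * shuffleCount (suc a) b ≡ suc (a + b) * shuffleCount a b
  shuffleCount-absorbˡ zero    zero    = refl
  shuffleCount-absorbˡ (suc a) zero    = cong (λ k → suc (suc k) * 1) (sym (ℕ.+-identityʳ a))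
  shuffleCount-absorbˡ a       (suc b) = begin
    suc a * (s a (suc b) + s (suc a) b)            ≡⟨ ℕ.*-distribˡ-+ (suc a) (s a (suc b)) _ ⟩
    suc a * s a (suc b) + suc a * s (suc a) b      ≡⟨ cong (suc a * s a (suc b) +_) (shuffleCount-absorbˡ a b) ⟩
    suc a * s a (suc b) + suc (a + b) * s a b      ≡⟨ cong (suc a * s a (suc b) +_) (shuffleCount-absorbʳ a b) ⟨
    suc a * s a (suc b) + suc b * s a (suc b)      ≡⟨ collect a b (s a (suc b)) ⟩
    suc (a + suc b) * s a (suc b)                  ∎
    where
    open ≡-Reasoning
    s = shuffleCount
    collect : ∀ a b x → suc a * x + suc b * x ≡ suc (a + suc b) * x
    collect = solve-∀

  shuffleCount-absorbʳ : ∀ a b → suc b * shuffleCount a (suc b) ≡ suc (a + b) * shuffleCount a b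
  shuffleCount-absorbʳ zero    b = refl
  shuffleCount-absorbʳ (suc a) b = begin
    suc b * (s a (suc b) + s (suc a) b)            ≡⟨ ℕ.*-distribˡ-+ (suc b) (s a (suc b)) _ ⟩
    suc b * s a (suc b) + suc b * s (suc a) b      ≡⟨ cong (_+ suc b * s (suc a) b) (shuffleCount-absorbʳ a b) ⟩
    suc (a + b) * s a b + suc b * s (suc a) b      ≡⟨ cong (_+ suc b * s (suc a) b) (shuffleCount-absorbˡ a b) ⟨
    suc a * s (suc a) b + suc b * s (suc a) b      ≡⟨ collect a b (s (suc a) b) ⟩
    suc (suc a + b) * s (suc a) b                  ∎
    where
    open ≡-Reasoning
    s = shuffleCount
    collect : ∀ a b x → suc a * x + suc b * x ≡ suc (suc a + b) * x
    collect = solve-∀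

-- Modulo p, C (n, j) vanishes for 0 < j < p ^ e when p ^ e ∣ n, so by Pascal's rule C (n − 1, j) ≡ ± 1.
∤-shuffleCount : ∀ {p} → Prime p → ∀ e a b → p ^ e ∣ suc (a + b) → a < p ^ e → ¬ p ∣ shuffleCount a b
∤-shuffleCount p-prime e zero    b _ _ p∣1 = ¬prime[1] (subst Prime (∣1⇒≡1 p∣1) p-prime)
∤-shuffleCount {p} p-prime e (suc a) b q∣n a+1<q p∣s =
  -- With n = a + b + 2, if p divided C (n - 1, a + 1), then by Pascal's rule it would divide C (n -
  -- 1, a), against the induction hypothesis.
  ∤-shuffleCount p-prime e a (suc b) q∣n′ (ℕ.<-trans (ℕ.n<1+n a) a+1<q)
    (∣m+n∣m⇒∣n (subst (p ∣_) (ℕ.+-comm (shuffleCount a (suc b)) _) p∣sum) p∣s)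
  where
  q∣n′ : p ^ e ∣ suc (a + suc b)
  q∣n′ = subst (λ k → p ^ e ∣ suc k) (sym (ℕ.+-suc a b)) q∣n

  p∣sum : p ∣ shuffleCount (suc a) (suc b)
  p∣sum with p ∣? shuffleCount (suc a) (suc b)
  ... | yes p∣ = p∣
  -- Absorption reads (a + 1) * C (n, a + 1) = n * C (n - 1, a). If p did not divide C (n, a + 1),
  -- then p ^ e would divide a + 1, which is smaller.
  ... | no p∤  = contradiction (∣⇒≤ (prime^∣-cancelˡ p-prime p∤ e
    (subst (p ^ e ∣_) (trans (sym (shuffleCount-absorbˡ a (suc b))) (ℕ.*-comm (suc a) _))
      (∣m⇒∣m*n _ q∣n′)))) (ℕ.<⇒≱ a+1<q)

-- Sums over lists

total : (X → ℕ) → List X → ℕ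
total g ws = sum (map g ws)

total-cong : {g h : X → ℕ} → g ≗ h → total g ≗ total h
total-cong g≗h ws = cong sum (map-cong g≗h ws)

total-++ : ∀ (g : X → ℕ) ws vs → total g (ws ++ vs) ≡ total g ws + total g vs
total-++ g ws vs = trans (cong sum (map-++ g ws vs)) (sum-++ (map g ws) (map g vs))

total-map : ∀ (g : B → ℕ) (f : X → B) ws → total g (map f ws) ≡ total (g ∘ f) ws
total-map g f ws = cong sum (sym (map-∘ ws))

total-↭ : ∀ (g : X → ℕ) {ws vs} → ws ↭ vs → total g ws ≡ total g vs
total-↭ g = sum-↭ ∘ ↭.map⁺ g

total-+ : ∀ (g h : X → ℕ) ws → total (λ w → g w + h w) ws ≡ total g ws + total h ws
total-+ g h []       = refl
total-+ g h (w ∷ ws) = trans (cong (g w + h w +_) (total-+ g h ws))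
  (interchange (g w) (h w) (total g ws) (total h ws))
  where
  interchange : ∀ a b c d → a + b + (c + d) ≡ a + c + (b + d)
  interchange = solve-∀

total-const : ∀ (g : X → ℕ) {c} ws → (∀ {w} → w ∈ ws → g w ≡ c) → total g ws ≡ length ws * c
total-const g []       _   = refl
total-const g (w ∷ ws) g≡c = cong₂ _+_ (g≡c (here refl)) (total-const g ws (g≡c ∘ there))

-- Multiplicities and identifications of list elements

module _ {X : Set a} (_≟_ : DecidableEquality X) where

  indicator : X → X → ℕ
  indicator c x = if does (x ≟ c) then 1 else 0

  count : X → List X → ℕ
  count c = total (indicator c)

  ∈⇒0<count : ∀ {c xs} → c ∈ xs → 0 < count c xs
  ∈⇒0<count {c} (here refl) with c ≟ c
  ... | yes _  = s≤s z≤n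
  ... | no c≢c = contradiction refl c≢c
  ∈⇒0<count (there c∈xs) = ℕ.≤-trans (∈⇒0<count c∈xs) (ℕ.m≤n+m _ _)

  remove : X → List X → List X
  remove c = filter (λ x → ¬? (x ≟ c))

  length-remove : ∀ c xs → count c xs + length (remove c xs) ≡ length xs
  length-remove c []       = refl
  length-remove c (x ∷ xs) with x ≟ c
  ... | yes _ = cong suc (length-remove c xs)
  ... | no _  = trans (ℕ.+-suc _ _) (cong suc (length-remove c xs))

  count-remove : ∀ {c d} → d ≢ c → ∀ xs → count d (remove c xs) ≡ count d xs
  count-remove d≢c [] = refl
  count-remove {c} {d} d≢c (x ∷ xs) with x ≟ c
  ... | no _ = cong (indicator d x +_) (count-remove d≢c xs)
  ... | yes refl with x ≟ d
  ...   | yes refl = contradiction refl d≢c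
  ...   | no _     = count-remove d≢c xs

  -- Take the head as a representative and discard all its copies: each representative uses up at
  -- least D places of the list.
  representatives : ∀ D xs → (∀ {c} → c ∈ xs → D ≤ count c xs) →
    ∃[ reps ] length reps * D ≤ length xs × (∀ {c} → c ∈ xs → c ∈ reps)
  representatives D xs = go xs (<-wellFounded (length xs))
    where
    go : ∀ xs → Acc _<_ (length xs) → (∀ {c} → c ∈ xs → D ≤ count c xs) →
         ∃[ reps ] length reps * D ≤ length xs × (∀ {c} → c ∈ xs → c ∈ reps)
    go [] _ _ = [] , z≤n , id
    go xs@(c ∷ _) (acc rec) D≤ = c ∷ proj₁ rest , bound , covers
      where
      shorter : length (remove c xs) < length xs
      shorter = subst (length (remove c xs) <_) (length-remove c xs)
        (ℕ.m<n+m (length (remove c xs)) (∈⇒0<count {c} {xs} (here refl)))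

      -- Discarding `c` leaves every other multiplicity unchanged, so the bound D survives.
      rest = go (remove c xs) (rec shorter) λ d∈ →
        let d∈xs , d≢c = ∈-filter⁻ (λ x → ¬? (x ≟ c)) {xs = xs} d∈
        in subst (D ≤_) (sym (count-remove d≢c xs)) (D≤ d∈xs)

      bound : D + length (proj₁ rest) * D ≤ length xs
      bound = subst (D + length (proj₁ rest) * D ≤_) (length-remove c xs)
        (ℕ.+-mono-≤ (D≤ (here refl)) (proj₁ (proj₂ rest)))

      covers : ∀ {d} → d ∈ xs → d ∈ c ∷ proj₁ rest
      covers {d} d∈xs with d ≟ c
      ... | yes d≡c = here d≡c
      ... | no d≢c  = there (proj₂ (proj₂ rest) (∈-filter⁺ (λ x → ¬? (x ≟ c)) d∈xs d≢c))

  -- The values in B need not have decidable equality. Finitely many equalities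
  -- between them are instead realised by a map q on the arguments that preserves f.
  module _ {B : Set b} (f : X → B) where

    private
      redirect : X → X → X → X
      redirect x y z = if does (z ≟ x) then y else z

      redirect-≡ : ∀ x y → redirect x y x ≡ redirect x y y
      redirect-≡ x y with x ≟ x | y ≟ x
      ... | yes _  | yes _ = refl
      ... | yes _  | no _  = refl
      ... | no x≢x | _     = contradiction refl x≢x

      redirect-invariant : ∀ {x y} → f x ≡ f y → ∀ z → f (redirect x y z) ≡ f z
      redirect-invariant {x} fx≡fy z with z ≟ x
      ... | yes refl = sym fx≡fy
      ... | no _     = refl

    -- Positions are matched from the end. Once `q` matches the tails, sending `q x` to `q y`
    -- matches the heads, and composition keeps the tails matched. The two merged elements have the
    -- same image under `f`.
    identify : ∀ xs ys → map f xs ≡ map f ys →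
      ∃[ q ] (∀ z → f (q z) ≡ f z) × map q xs ≡ map q ys
    identify []       []       _  = id , (λ _ → refl) , refl
    identify (x ∷ xs) (y ∷ ys) eq with identify xs ys (∷-injectiveʳ eq)
    ... | q , fq , qxs≡qys =
      r ∘ q
      , (λ z → trans (redirect-invariant fqx≡fqy (q z)) (fq z))
      , cong₂ _∷_ (redirect-≡ (q x) (q y))
          (trans (map-∘ xs) (trans (cong (map r) qxs≡qys) (sym (map-∘ ys))))
      where
      r = redirect (q x) (q y)
      fqx≡fqy = trans (fq x) (trans (∷-injectiveˡ eq) (sym (fq y)))

    -- Here `ys′` is a rearrangement of `xs` whose images under `f` agree with those of `ys`
    -- position by position, which reduces to `identify`.
    identify-↭ : ∀ xs ys → map f xs ↭ map f ys →
      ∃[ q ] (∀ z → f (q z) ≡ f z) × map q xs ↭ map q ys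
    identify-↭ xs ys fxs↭fys with ↭.↭-map-inv f fxs↭fys
    ... | ys′ , fys≡ , xs↭ys′ with identify ys′ ys (sym fys≡)
    ...   | q , fq , eq = q , fq , ↭-trans (↭.map⁺ q xs↭ys′) (↭-reflexive eq)

    identify-all : ∀ (pairs : List (List X × List X)) →
      (∀ {xs ys} → (xs , ys) ∈ pairs → map f xs ↭ map f ys) →
      ∃[ q ] (∀ z → f (q z) ≡ f z) × (∀ {xs ys} → (xs , ys) ∈ pairs → map q xs ↭ map q ys)
    identify-all [] _ = id , (λ _ → refl) , λ ()
    identify-all ((xs , ys) ∷ pairs) hyp with identify-all pairs (hyp ∘ there)
    ... | q , fq , q-pairs with identify-↭ (map q xs) (map q ys) f-q-↭
      where
      unmap : ∀ zs → map f zs ≡ map f (map q zs)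
      unmap zs = trans (map-cong (sym ∘ fq) zs) (map-∘ zs)
      f-q-↭ : map f (map q xs) ↭ map f (map q ys)
      f-q-↭ = subst₂ _↭_ (unmap xs) (unmap ys) (hyp (here refl))
    -- Composing with `r` cannot spoil the earlier pairs, since `map r` respects `_↭_`.
    ...   | r , fr , r-↭ = r ∘ q , (λ z → trans (fr (q z)) (fq z)) , λ where
      (here refl) → subst₂ _↭_ (sym (map-∘ xs)) (sym (map-∘ ys)) r-↭
      (there i) → subst₂ _↭_ (sym (map-∘ _)) (sym (map-∘ _)) (↭.map⁺ r (q-pairs i))

-- Shuffles

shuffle : List A → List A → List (List A)
shuffle []       ys       = [ ys ]
shuffle (x ∷ xs) []       = [ x ∷ xs ]
shuffle (x ∷ xs) (y ∷ ys) = map (x ∷_) (shuffle xs (y ∷ ys)) ++ map (y ∷_) (shuffle (x ∷ xs) ys)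

shuffle-[] : (xs : List A) → shuffle xs [] ≡ [ xs ]
shuffle-[] []       = refl
shuffle-[] (_ ∷ _)  = refl

length-shuffle : (xs ys : List A) → length (shuffle xs ys) ≡ shuffleCount (length xs) (length ys)
length-shuffle []       ys       = refl
length-shuffle (x ∷ xs) []       = refl
length-shuffle (x ∷ xs) (y ∷ ys) = begin
  length (map (x ∷_) xws ++ map (y ∷_) yws)          ≡⟨ length-++ (map (x ∷_) xws) ⟩
  length (map (x ∷_) xws) + length (map (y ∷_) yws)  ≡⟨ cong₂ _+_ (length-map (x ∷_) xws) (length-map (y ∷_) yws) ⟩
  length xws + length yws                            ≡⟨ cong₂ _+_ (length-shuffle xs (y ∷ ys)) (length-shuffle (x ∷ xs) ys) ⟩
  shuffleCount (length (x ∷ xs)) (length (y ∷ ys)) ∎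
  where
  open ≡-Reasoning
  xws = shuffle xs (y ∷ ys)
  yws = shuffle (x ∷ xs) ys

∈-shuffle-∷ˡ : ws ∈ shuffle xs ys → x ∷ ws ∈ shuffle (x ∷ xs) ys
∈-shuffle-∷ˡ {xs = []}     {[]}    (here refl) = here refl
∈-shuffle-∷ˡ {xs = _ ∷ _}  {[]}    (here refl) = here refl
∈-shuffle-∷ˡ {xs = _}      {_ ∷ _} ws∈         = ∈-++⁺ˡ (∈-map⁺ _ ws∈)

∈-shuffle-∷ʳ : ws ∈ shuffle xs ys → y ∷ ws ∈ shuffle xs (y ∷ ys)
∈-shuffle-∷ʳ {xs = []}     (here refl) = here refl
∈-shuffle-∷ʳ {xs = x ∷ xs} {ys} {y} ws∈ = ∈-++⁺ʳ (map (x ∷_) (shuffle xs (y ∷ ys))) (∈-map⁺ _ ws∈)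

∈-shuffle⇒ : ∀ xs ys → ws ∈ shuffle xs ys → xs ⊆ ws × ys ⊆ ws × ws ↭ xs ++ ys
∈-shuffle⇒ []       ys       (here refl) = minimum ys , ⊆-refl , ↭-refl
∈-shuffle⇒ (x ∷ xs) []       (here refl) = ⊆-refl , minimum _ , ↭-sym (↭.++-identityʳ (x ∷ xs))
∈-shuffle⇒ (x ∷ xs) (y ∷ ys) ws∈ with ∈-++⁻ (map (x ∷_) (shuffle xs (y ∷ ys))) ws∈
... | inj₁ ws∈x with v , v∈ , refl ← ∈-map⁻ (x ∷_) ws∈x
  with xs⊆ , ys⊆ , v↭ ← ∈-shuffle⇒ xs (y ∷ ys) v∈ = refl ∷ xs⊆ , x ∷ʳ ys⊆ , prep x v↭
... | inj₂ ws∈y with v , v∈ , refl ← ∈-map⁻ (y ∷_) ws∈y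
  with xs⊆ , ys⊆ , v↭ ← ∈-shuffle⇒ (x ∷ xs) ys v∈ =
    y ∷ʳ xs⊆ , refl ∷ ys⊆ , ↭-trans (prep y v↭) (↭-sym (↭.shift y (x ∷ xs) ys))

disjoint-tailˡ : Disjoint (x ∷ xs) ys → Disjoint xs ys
disjoint-tailˡ dis (v∈xs , v∈ys) = dis (there v∈xs , v∈ys)

disjoint-tailʳ : Disjoint xs (y ∷ ys) → Disjoint xs ys
disjoint-tailʳ dis (v∈xs , v∈ys) = dis (v∈xs , there v∈ys)

-- By disjointness no position of `ws` is used by both embeddings.
disjoint-⊆⇒length-≤ : Disjoint xs ys → xs ⊆ ws → ys ⊆ ws → length xs + length ys ≤ length ws
disjoint-⊆⇒length-≤ dis []         []         = z≤n
disjoint-⊆⇒length-≤ dis (_ ∷ʳ p)   (_ ∷ʳ q)   = ℕ.m≤n⇒m≤1+n (disjoint-⊆⇒length-≤ dis p q)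
disjoint-⊆⇒length-≤ dis (refl ∷ p) (_ ∷ʳ q)   = s≤s (disjoint-⊆⇒length-≤ (disjoint-tailˡ dis) p q)
disjoint-⊆⇒length-≤ {xs = xs} {ys = _ ∷ ys} {ws = _ ∷ ws} dis (_ ∷ʳ p) (refl ∷ q) =
  subst (_≤ suc (length ws)) (sym (ℕ.+-suc (length xs) (length ys))) (s≤s (disjoint-⊆⇒length-≤ (disjoint-tailʳ dis) p q))
disjoint-⊆⇒length-≤ dis (refl ∷ p) (refl ∷ q) = contradiction (here refl , here refl) dis

-- Follow both embeddings along `ws`. A letter used by neither would leave a remainder too short for
-- `xs` and `ys`; a letter used by both would contradict disjointness.
⊆⇒∈-shuffle : Disjoint xs ys → length ws ≡ length xs + length ys → xs ⊆ ws → ys ⊆ ws → ws ∈ shuffle xs ys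
⊆⇒∈-shuffle dis eq []         []         = here refl
⊆⇒∈-shuffle {ws = _ ∷ ws} dis eq (_ ∷ʳ p) (_ ∷ʳ q) =
  contradiction (subst (_≤ length ws) (sym eq) (disjoint-⊆⇒length-≤ dis p q)) ℕ.1+n≰n
⊆⇒∈-shuffle {xs = _ ∷ xs} {ys = ys} dis eq (refl ∷ p) (_ ∷ʳ q) = ∈-shuffle-∷ˡ {xs = xs} {ys = ys}
  (⊆⇒∈-shuffle (disjoint-tailˡ dis) (ℕ.suc-injective eq) p q)
⊆⇒∈-shuffle {xs = xs} {ys = _ ∷ ys} dis eq (_ ∷ʳ p) (refl ∷ q) = ∈-shuffle-∷ʳ {xs = xs}
  (⊆⇒∈-shuffle (disjoint-tailʳ dis) (ℕ.suc-injective (trans eq (ℕ.+-suc (length xs) (length ys)))) p q)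
⊆⇒∈-shuffle dis eq (refl ∷ p) (refl ∷ q) = contradiction (here refl , here refl) dis

-- Words from the two halves of the recursion differ in their first letter.
shuffle-unique : ∀ (xs ys : List A) → Disjoint xs ys → Unique (shuffle xs ys)
shuffle-unique []       ys       _   = [] ∷ []
shuffle-unique (x ∷ xs) []       _   = [] ∷ []
shuffle-unique (x ∷ xs) (y ∷ ys) dis = Unique.++⁺
  (Unique.map⁺ ∷-injectiveʳ (shuffle-unique xs (y ∷ ys) (disjoint-tailˡ dis)))
  (Unique.map⁺ ∷-injectiveʳ (shuffle-unique (x ∷ xs) ys (disjoint-tailʳ dis)))
  heads-differ
  where
  heads-differ : Disjoint (map (x ∷_) (shuffle xs (y ∷ ys))) (map (y ∷_) (shuffle (x ∷ xs) ys))
  heads-differ (v∈x , v∈y) with ∈-map⁻ (x ∷_) v∈x | ∈-map⁻ (y ∷_) v∈y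
  ... | _ , _ , refl | _ , _ , eq = dis (here refl , here (∷-injectiveˡ eq))

total-shuffle-∷ : ∀ (g : List A → ℕ) x xs y ys → total g (shuffle (x ∷ xs) (y ∷ ys)) ≡
  total (g ∘ (x ∷_)) (shuffle xs (y ∷ ys)) + total (g ∘ (y ∷_)) (shuffle (x ∷ xs) ys)
total-shuffle-∷ g x xs y ys = trans (total-++ g (map (x ∷_) (shuffle xs (y ∷ ys))) _)
  (cong₂ _+_ (total-map g (x ∷_) (shuffle xs (y ∷ ys))) (total-map g (y ∷_) (shuffle (x ∷ xs) ys)))

-- Both sides sum `g` over the shuffles of three words. Grouping by first letter gives three smaller
-- instances in which `g` is precomposed with prepending that letter, so the weight has to be
-- arbitrary.
total-shuffle-assoc : ∀ (g : List A → ℕ) xs ys zs →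
  total (λ w → total g (shuffle w zs)) (shuffle xs ys) ≡ total (λ w → total g (shuffle xs w)) (shuffle ys zs)
total-shuffle-assoc g [] ys zs = trans (ℕ.+-identityʳ _)
  (total-cong (λ w → sym (ℕ.+-identityʳ (g w))) (shuffle ys zs))
total-shuffle-assoc g (x ∷ xs) [] zs = refl
total-shuffle-assoc g (x ∷ xs) (y ∷ ys) [] = trans
  (total-cong (λ w → trans (cong (total g) (shuffle-[] w)) (ℕ.+-identityʳ (g w))) (shuffle (x ∷ xs) (y ∷ ys)))
  (sym (ℕ.+-identityʳ _))
total-shuffle-assoc {A = A} g X@(x ∷ xs) Y@(y ∷ ys) Z@(z ∷ zs) = begin
  total (left g Z) (shuffle X Y)
    ≡⟨ total-shuffle-∷ (left g Z) x xs y ys ⟩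
  total (left g Z ∘ (x ∷_)) (shuffle xs Y) + total (left g Z ∘ (y ∷_)) (shuffle X ys)
    ≡⟨ cong₂ _+_ (split-left x (shuffle xs Y)) (split-left y (shuffle X ys)) ⟩
  (total (left gx Z) (shuffle xs Y) + total (left gz zs ∘ (x ∷_)) (shuffle xs Y)) +
  (total (left gy Z) (shuffle X ys) + total (left gz zs ∘ (y ∷_)) (shuffle X ys))
    ≡⟨ interchange (total (left gx Z) (shuffle xs Y)) _ (total (left gy Z) (shuffle X ys)) _ ⟩
  total (left gx Z) (shuffle xs Y) + (total (left gy Z) (shuffle X ys) +
  (total (left gz zs ∘ (x ∷_)) (shuffle xs Y) + total (left gz zs ∘ (y ∷_)) (shuffle X ys)))
    -- Words beginning with z occur in both summands, according to whether the shuffle of `X` and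
    -- `Y` begins with x or y; together they range over all of `shuffle X Y`.
    ≡⟨ cong (λ t → total (left gx Z) (shuffle xs Y) + (total (left gy Z) (shuffle X ys) + t))
         (total-shuffle-∷ (left gz zs) x xs y ys) ⟨
  total (left gx Z) (shuffle xs Y) + (total (left gy Z) (shuffle X ys) + total (left gz zs) (shuffle X Y))
    ≡⟨ cong₂ _+_ (total-shuffle-assoc gx xs Y Z)
         (cong₂ _+_ (total-shuffle-assoc gy X ys Z) (total-shuffle-assoc gz X Y zs)) ⟩
  total (right gx xs) (shuffle Y Z) + (total (right gy X) (shuffle ys Z) + total (right gz X) (shuffle Y zs))
    -- On the right it is the words beginning with x that come in two groups.
    ≡⟨ cong (_+ (total (right gy X) (shuffle ys Z) + total (right gz X) (shuffle Y zs)))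
         (total-shuffle-∷ (right gx xs) y ys z zs) ⟩
  (total (right gx xs ∘ (y ∷_)) (shuffle ys Z) + total (right gx xs ∘ (z ∷_)) (shuffle Y zs)) +
  (total (right gy X) (shuffle ys Z) + total (right gz X) (shuffle Y zs))
    ≡⟨ interchange′ (total (right gx xs ∘ (y ∷_)) (shuffle ys Z)) _ _ _ ⟩
  (total (right gx xs ∘ (y ∷_)) (shuffle ys Z) + total (right gy X) (shuffle ys Z)) +
  (total (right gx xs ∘ (z ∷_)) (shuffle Y zs) + total (right gz X) (shuffle Y zs))
    ≡⟨ cong₂ _+_ (split-right y (shuffle ys Z)) (split-right z (shuffle Y zs)) ⟨
  total (right g X ∘ (y ∷_)) (shuffle ys Z) + total (right g X ∘ (z ∷_)) (shuffle Y zs)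
    ≡⟨ total-shuffle-∷ (right g X) y ys z zs ⟨
  total (right g X) (shuffle Y Z) ∎
  where
  open ≡-Reasoning
  left right : (List A → ℕ) → List A → List A → ℕ
  left  h vs w = total h (shuffle w vs)
  right h vs w = total h (shuffle vs w)
  gx = g ∘ (x ∷_)
  gy = g ∘ (y ∷_)
  gz = g ∘ (z ∷_)

  split-left : ∀ u ws → total (left g Z ∘ (u ∷_)) ws ≡
    total (left (g ∘ (u ∷_)) Z) ws + total (left gz zs ∘ (u ∷_)) ws
  split-left u ws = trans (total-cong (λ w → total-shuffle-∷ g u w z zs) ws) (total-+ _ _ ws)

  split-right : ∀ u ws → total (right g X ∘ (u ∷_)) ws ≡
    total (right gx xs ∘ (u ∷_)) ws + total (right (g ∘ (u ∷_)) X) ws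
  split-right u ws = trans (total-cong (λ w → total-shuffle-∷ g x xs u w) ws) (total-+ _ _ ws)

  interchange : ∀ a b c d → (a + b) + (c + d) ≡ a + (c + (b + d))
  interchange = solve-∀

  interchange′ : ∀ a b c d → (a + b) + (c + d) ≡ (a + c) + (b + d)
  interchange′ = solve-∀

-- Permutations as words

record IsWord (m : ℕ) (w : List ℕ) : Set where
  constructor isWord
  field
    length≡  : length w ≡ m
    positive : All (0 <_) w
    unique   : Unique w

open IsWord

word : Perm m → List ℕ
word π = toList (letters π)

unique-toList⁺ : {v : Vec ℕ m} → Vec.Unique v → Unique (toList v)
unique-toList⁺ Vec.[]       = []
unique-toList⁺ (x Vec.∷ xs) = VecAll.toList⁺ x ∷ unique-toList⁺ xs

unique-toList⁻ : {v : Vec ℕ m} → Unique (toList v) → Vec.Unique v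
unique-toList⁻ {v = []}    []       = Vec.[]
unique-toList⁻ {v = _ ∷ _} (x ∷ xs) = VecAll.toList⁻ x Vec.∷ unique-toList⁻ xs

unique? : (w : List ℕ) → Dec (Unique w)
unique? = allPairs? (λ x y → ¬? (x ℕ.≟ y))

word-isWord : (π : Perm m) → IsWord m (word π)
word-isWord (mkPerm v pos dis) = isWord
  (length-toList v)
  -- The side conditions of a `Perm` are irrelevant; decidability recovers them.
  (recompute (all? (0 ℕ.<?_) (toList v)) (VecAll.toList⁺ pos))
  (recompute (unique? (toList v)) (unique-toList⁺ dis))

toPerm : ∀ w → IsWord m w → Perm m
toPerm w (isWord len pos uni) = mkPerm (cast len (fromList w))
  (VecAll.toList⁻ (subst (All (0 <_)) (sym letters≡) pos))
  (unique-toList⁻ (subst Unique (sym letters≡) uni))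
  where
  letters≡ : toList (cast len (fromList w)) ≡ w
  letters≡ = trans (toList-cast len (fromList w)) (toList∘fromList w)

word-toPerm : ∀ w (wf : IsWord m w) → word (toPerm w wf) ≡ w
word-toPerm w (isWord len _ _) = trans (toList-cast len (fromList w)) (toList∘fromList w)

word-injective : {π σ : Perm m} → word π ≡ word σ → π ≡ σ
word-injective {π = π} {σ} eq = letters-injective
  (trans (sym (cast-is-id refl (letters π))) (toList-injective refl (letters π) (letters σ) eq))
  where
  letters-injective : {π σ : Perm m} → letters π ≡ letters σ → π ≡ σ
  letters-injective refl = refl

parse : ∀ m → List ℕ → Maybe (Perm m)
parse m w with length w ℕ.≟ m ×-dec all? (0 ℕ.<?_) w ×-dec unique? w
... | yes (len , pos , uni) = just (toPerm w (isWord len pos uni))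
... | no _                  = nothing

parse-word : (π : Perm m) → parse m (word π) ≡ just π
parse-word {m} π with length (word π) ℕ.≟ m ×-dec all? (0 ℕ.<?_) (word π) ×-dec unique? (word π)
... | yes (len , pos , uni) = cong just (word-injective (word-toPerm (word π) (isWord len pos uni)))
... | no ¬wf with isWord len pos uni ← word-isWord π = contradiction (len , pos , uni) ¬wf

IsWord-resp-↭ : π ↭ σ → IsWord m π → IsWord m σ
IsWord-resp-↭ π↭σ (isWord len pos uni) = isWord
  (trans (sym (↭.↭-length π↭σ)) len)
  (↭.All-resp-↭ π↭σ pos)
  (↭ₛ.Unique-resp-↭ (setoid ℕ) (↭⇒↭ₛ π↭σ) uni)

record Separated (k l : ℕ) (π σ : List ℕ) : Set where
  constructor separated
  field
    wordˡ : IsWord k π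
    wordʳ : IsWord l σ
    below : All (λ x → All (x <_) σ) π

open Separated

separated⇒disjoint : Separated k l π σ → Disjoint π σ
separated⇒disjoint sep (v∈π , v∈σ) = ℕ.<-irrefl refl (All.lookup (All.lookup (below sep) v∈π) v∈σ)

++-isWord : Separated k l π σ → IsWord (k + l) (π ++ σ)
++-isWord {π = π} sep@(separated πw σw _) = isWord
  (trans (length-++ π) (cong₂ _+_ (length≡ πw) (length≡ σw)))
  (All.++⁺ (positive πw) (positive σw))
  (Unique.++⁺ (unique πw) (unique σw) (separated⇒disjoint sep))

Separated-resp-↭ˡ : π ↭ ρ → Separated k l π σ → Separated k l ρ σ
Separated-resp-↭ˡ π↭ρ (separated πw σw π<σ) =
  separated (IsWord-resp-↭ π↭ρ πw) σw (↭.All-resp-↭ π↭ρ π<σ)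

singleton-separated : 0 < m → IsWord l σ → All (m <_) σ → Separated 1 l [ m ] σ
singleton-separated 0<m σw m<σ = separated (isWord refl (0<m ∷ []) ([] ∷ [])) σw (m<σ ∷ [])

interval : ℕ → ℕ → List ℕ
interval m = applyUpTo (m +_)

length-interval : ∀ m l → length (interval m l) ≡ l
length-interval m = length-applyUpTo (m +_)

interval-≥ : ∀ m l → All (m ≤_) (interval m l)
interval-≥ m l = All.applyUpTo⁺₂ (m +_) l (ℕ.m≤m+n m)

interval-isWord : ∀ m l → IsWord l (interval (suc m) l)
interval-isWord m l = isWord
  (length-interval (suc m) l)
  (All.applyUpTo⁺₂ (suc m +_) l (λ _ → s≤s z≤n))
  (Unique.applyUpTo⁺₁ (suc m +_) l (λ i<j _ → ℕ.<⇒≢ (ℕ.+-monoʳ-< (suc m) i<j)))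

intervals-separated : ∀ m k l → Separated k l (interval (suc m) k) (interval (suc m + k) l)
intervals-separated m k l = separated (interval-isWord m k) (interval-isWord (m + k) l)
  (All.applyUpTo⁺₁ (suc m +_) k λ i<k →
    All.map (ℕ.<-≤-trans (ℕ.+-monoʳ-< (suc m) i<k)) (interval-≥ (suc m + k) l))

split-minimum : ∀ x xs → Unique (x ∷ xs) →
  ∃[ m ] ∃[ us ] ∃[ vs ] x ∷ xs ≡ us ++ m ∷ vs × All (m <_) (us ++ vs)
split-minimum x [] _ = x , [] , [] , refl , []
split-minimum x (y ∷ ys) (x∉ ∷ uni) with split-minimum y ys uni
... | m , us , vs , eq , m< with ℕ.<-cmp x m
...   | tri> _ _ m<x = m , x ∷ us , vs , cong (x ∷_) eq , m<x ∷ m<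
...   | tri≈ _ refl _ = contradiction refl
  (All.lookup x∉ (subst (m ∈_) (sym eq) (∈-++⁺ʳ us (here refl))))
-- The tail is a rearrangement of m with `us` and `vs`, whose letters exceed m, so x lies below all
-- of it.
...   | tri< x<m _ _ = x , [] , y ∷ ys , refl ,
  ↭.All-resp-↭ (↭-trans (↭-sym (↭.shift m us vs)) (↭-reflexive (sym eq)))
    (x<m ∷ All.map (ℕ.<-trans x<m) m<)

-- This places an arbitrary permutation in a shuffle set to which compatibility applies.
minimum-shuffle : IsWord (suc l) w → ∃[ m ] ∃[ ρ ] Separated 1 l [ m ] ρ × w ∈ shuffle [ m ] ρ
minimum-shuffle {l} {x ∷ xs} ww with split-minimum x xs (unique ww)
... | m , us , vs , eq , m< = m , us ++ vs , sep ,
  subst (_∈ shuffle [ m ] (us ++ vs)) (sym eq)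
    (⊆⇒∈-shuffle (separated⇒disjoint sep) (↭.↭-length (↭.shift m us vs))
      (++⁺ (minimum us) (refl ∷ minimum vs)) (++⁺ (⊆-refl {x = us}) (m ∷ʳ ⊆-refl)))
  where
  sep : Separated 1 l [ m ] (us ++ vs)
  sep with isWord len (0<m ∷ pos) (_ ∷ uni) ← IsWord-resp-↭ (↭-trans (↭-reflexive eq) (↭.shift m us vs)) ww =
    singleton-separated 0<m (isWord (ℕ.suc-injective len) pos uni) m<

words⇒perms : ∀ ws → (∀ {w} → w ∈ ws → IsWord m w) → ∃[ ts ] map (word {m}) ts ≡ ws
words⇒perms []       _  = [] , refl
words⇒perms (w ∷ ws) wf with words⇒perms ws (wf ∘ there)
... | ts , eq = toPerm w (wf (here refl)) ∷ ts , cong₂ _∷_ (word-toPerm w (wf (here refl))) eq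

module _ {π σ : List ℕ} (sep : Separated k l π σ) where

  lower : Perm k
  lower = toPerm π (wordˡ sep)

  upper : Perm l
  upper = toPerm σ (wordʳ sep)

  lower≪upper : lower ≪ upper
  lower≪upper i j = VecAll.lookup⁺ (VecAll.lookup⁺ vec-below i) j
    where
    vec-below : Vec.All (λ x → Vec.All (x <_) (letters upper)) (letters lower)
    vec-below = VecAll.toList⁻ (subst (All _) (sym (word-toPerm π (wordˡ sep)))
      (All.map (λ x< → VecAll.toList⁻ (subst (All _) (sym (word-toPerm σ (wordʳ sep))) x<)) (below sep)))

  enumeration : ∃[ ts ] map word ts ≡ shuffle π σ × ts Enumerates lower ⧢ upper
  enumeration with words⇒perms {k + l} (shuffle π σ)
    (λ w∈ → IsWord-resp-↭ (↭-sym (proj₂ (proj₂ (∈-shuffle⇒ π σ w∈)))) (++-isWord sep))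
  ... | ts , eq = ts , eq , record
    { once    = Unique.map⁻ (subst Unique (sym eq) (shuffle-unique π σ disjoint))
    ; members = λ τ → mk⇔ to (from τ)
    }
    where
    disjoint = separated⇒disjoint sep
    lower≡ = word-toPerm π (wordˡ sep)
    upper≡ = word-toPerm σ (wordʳ sep)

    to : ∀ {τ} → τ ∈ ts → τ ∈ lower ⧢ upper
    to {τ} τ∈ts with π⊆ , σ⊆ , _ ← ∈-shuffle⇒ π σ (subst (word τ ∈_) eq (∈-map⁺ word τ∈ts)) =
      subst (_⊆ word τ) (sym lower≡) π⊆ , subst (_⊆ word τ) (sym upper≡) σ⊆

    from : ∀ τ → τ ∈ lower ⧢ upper → τ ∈ ts
    -- τ has exactly k + l letters, so containing both words makes it one of their shuffles.
    from τ (π⊆ , σ⊆) with ∈-map⁻ word (subst (word τ ∈_) (sym eq) (⊆⇒∈-shuffle disjoint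
      (trans (length-toList (letters τ)) (sym (cong₂ _+_ (length≡ (wordˡ sep)) (length≡ (wordʳ sep)))))
      (subst (_⊆ word τ) lower≡ π⊆) (subst (_⊆ word τ) upper≡ σ⊆)))
    ... | τ′ , τ′∈ts , τ≡τ′ = subst (_∈ ts) (sym (word-injective τ≡τ′)) τ′∈ts

-- Values of the statistic on shuffle sets

wordValue : Statistic A n → List ℕ → Maybe A
-- Lists that are not permutations of length n get the default `nothing`, so values are defined on
-- all lists.
wordValue {n = n} st w = Maybe.map (value st ≤-refl) (parse n w)

wordValue-word : (st : Statistic A n) (τ : Perm n) → wordValue st (word τ) ≡ just (value st ≤-refl τ)
wordValue-word st τ = cong (Maybe.map (value st ≤-refl)) (parse-word τ)

-- Both parts are nonempty, hence shorter than n, and triviality there supplies the two equalities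
-- of values that compatibility asks for.
shuffle-values : (st : Statistic A n) → WeaklyShuffleCompatible st → Trivial (restrict (pred[n]≤n {n}) st) →
  suc k + suc l ≡ n → ∀ {π π′ σ σ′} →
  Separated (suc k) (suc l) π σ → Separated (suc k) (suc l) π′ σ′ →
  map (wordValue st) (shuffle π σ) ↭ map (wordValue st) (shuffle π′ σ′)
shuffle-values {k = k} {l} st compatible trivial refl sep sep′
  with enumeration sep | enumeration sep′
... | ts , words≡ , enum | ts′ , words≡′ , enum′ = subst₂ _↭_ (unwrap ts words≡) (unwrap ts′ words≡′) (↭.map⁺ just
    (compatible (ℕ.m≤m+n (suc k) (suc l)) (ℕ.m≤n+m (suc l) (suc k)) ≤-refl
      (lower sep) (lower sep′) (upper sep) (upper sep′) (lower≪upper sep) (lower≪upper sep′)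
      (trivial (suc k) (subst (suc k ≤_) (sym (ℕ.+-suc k l)) (s≤s (ℕ.m≤m+n k l))) _ _)
      (trivial (suc l) (ℕ.m≤n+m (suc l) k) _ _)
      ts ts′ enum enum′))
  where
  unwrap : ∀ us {ws} → map word us ≡ ws → map just (map (value st ≤-refl) us) ≡ map (wordValue st) ws
  unwrap us refl = trans (sym (map-∘ us)) (trans (map-cong (sym ∘ wordValue-word st) us) (map-∘ us))

atMost1⇒trivial : (st : Statistic A n) → AtMostClassesOn n ≤-refl st 1 → TrivialOn n ≤-refl st
atMost1⇒trivial st ([] , _ , covers) τ _ with () ← covers τ
atMost1⇒trivial st (_ ∷ [] , _ , covers) τ τ′ with covers τ | covers τ′
... | here eq | here eq′ = trans eq (sym eq′)
atMost1⇒trivial st (_ ∷ _ ∷ _ , s≤s () , _)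

_≟ʷ_ : DecidableEquality (List ℕ)
_≟ʷ_ = ≡-dec ℕ._≟_

-- Classes among the insertions of the least letter, for n = N + 2

module _ {A : Set a} {N : ℕ} (st : Statistic A (suc (suc N))) (compatible : WeaklyShuffleCompatible st)
         (trivial : Trivial (restrict (pred[n]≤n {suc (suc N)}) st)) where

  private
    f : List ℕ → Maybe A
    f = wordValue st

    σ₀ : List ℕ
    σ₀ = interval 2 (suc N)

    insertions : List (List ℕ)
    insertions = shuffle [ 1 ] σ₀

    -- The letters 2 to a + 1 and a + 2 to n. Thus `1 ∷ P a` has length k = a + 1, and the
    -- subtraction is exact whenever a is at most N.
    P R : ℕ → List ℕ
    P a = interval 2 a
    R a = interval (2 + a) (suc (N ∸ a))

    -- The equalities of multisets behind the double count: the first family is for shuffling `P a`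
    -- with `R a` first, the second for shuffling 1 into `P a` first.
    comparisons : ℕ → List (List (List ℕ) × List (List ℕ))
    comparisons a =
      map (λ σ → shuffle [ 1 ] σ , insertions) (shuffle (P a) (R a)) ++
      map (λ π → shuffle π (R a) , shuffle (1 ∷ P a) (R a)) (shuffle [ 1 ] (P a))

    σ₀-separated : Separated 1 (suc N) [ 1 ] σ₀
    σ₀-separated = singleton-separated (s≤s z≤n) (interval-isWord 1 (suc N)) (interval-≥ 2 (suc N))

    comparisons-valid : ∀ {a} → a < suc N → ∀ {xs ys} → (xs , ys) ∈ comparisons a → map f xs ↭ map f ys
    comparisons-valid {a} (s≤s a≤N) i∈
      with ∈-++⁻ (map (λ σ → shuffle [ 1 ] σ , insertions) (shuffle (P a) (R a))) i∈
    ... | inj₁ i∈₁ with σ , σ∈ , refl ← ∈-map⁻ _ i∈₁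
                   with _ , _ , σ↭ ← ∈-shuffle⇒ (P a) (R a) σ∈ =
      -- The letters of σ are those of `P a` and `R a`, all at least 2, so 1 lies below them.
      shuffle-values st compatible trivial refl
        (singleton-separated (s≤s z≤n)
          (IsWord-resp-↭ (↭-sym σ↭) (subst (λ c → IsWord c (P a ++ R a)) a+b
            (++-isWord (intervals-separated 1 a (suc (N ∸ a))))))
          (↭.All-resp-↭ (↭-sym σ↭) (All.++⁺ (interval-≥ 2 a)
            (All.map (ℕ.≤-trans (ℕ.m≤m+n 2 a)) (interval-≥ (2 + a) (suc (N ∸ a)))))))
        σ₀-separated
      where
      a+b : a + suc (N ∸ a) ≡ suc N
      a+b = trans (ℕ.+-suc a (N ∸ a)) (cong suc (ℕ.m+[n∸m]≡n a≤N))
    ... | inj₂ i∈₂ with π , π∈ , refl ← ∈-map⁻ _ i∈₂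
                   with _ , _ , π↭ ← ∈-shuffle⇒ [ 1 ] (P a) π∈ =
      -- π rearranges `1 ∷ P a`, so it stays below `R a`.
      shuffle-values st compatible trivial (cong suc (trans (ℕ.+-suc a (N ∸ a)) (cong suc (ℕ.m+[n∸m]≡n a≤N))))
        (Separated-resp-↭ˡ (↭-sym π↭) sep) sep
      where
      sep : Separated (suc a) (suc (N ∸ a)) (1 ∷ P a) (R a)
      sep = intervals-separated 0 (suc a) (suc (N ∸ a))

    -- One map `q` has to serve every a, because the divisibilities found for different prime powers
    -- must concern the same multiplicities.
    all-comparisons : List (List (List ℕ) × List (List ℕ))
    all-comparisons = concat (applyUpTo comparisons (suc N))

    all-comparisons-valid : ∀ {xs ys} → (xs , ys) ∈ all-comparisons → map f xs ↭ map f ys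
    all-comparisons-valid i∈ with ∈-concat⁻′ (applyUpTo comparisons (suc N)) i∈
    ... | _ , i∈c , c∈ with a , a<n , refl ← ∈-applyUpTo⁻ comparisons c∈ = comparisons-valid a<n i∈c

    abstract
      identification : ∃[ q ] (∀ w → f (q w) ≡ f w) ×
        (∀ {xs ys} → (xs , ys) ∈ all-comparisons → map q xs ↭ map q ys)
      identification = identify-all _≟ʷ_ f all-comparisons all-comparisons-valid

    q : List ℕ → List ℕ
    q = proj₁ identification

    fq : ∀ w → f (q w) ≡ f w
    fq = proj₁ (proj₂ identification)

    q-↭ : ∀ {a} → a < suc N → ∀ {xs ys} → (xs , ys) ∈ comparisons a → map q xs ↭ map q ys
    q-↭ a<n i∈ = proj₂ (proj₂ identification) (∈-concat⁺′ i∈ (∈-applyUpTo⁺ comparisons a<n))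

    -- What is counted is a fibre of `q`. Since `q` preserves `f`, its fibres refine the classes,
    -- and a bound on the number of fibres bounds the number of classes.
    multiplicity : List ℕ → ℕ
    multiplicity c = count _≟ʷ_ c (map q insertions)

    -- Count the class of c in {1} ⧢ P ⧢ R in two ways.
    multiplicity-∣ : ∀ c {a} → a < suc N → suc a ∣ shuffleCount a (suc (N ∸ a)) * multiplicity c
    multiplicity-∣ c {a} a<n = divides ν (begin
      shuffleCount a (suc (N ∸ a)) * multiplicity c            ≡⟨ cong (_* multiplicity c) lengthʳ ⟨
      length (shuffle (P a) (R a)) * multiplicity c            ≡⟨ total-const _ (shuffle (P a) (R a)) constʳ ⟨
      total (λ w → total g (shuffle [ 1 ] w)) (shuffle (P a) (R a)) ≡⟨ total-shuffle-assoc g [ 1 ] (P a) (R a) ⟨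
      total (λ w → total g (shuffle w (R a))) (shuffle [ 1 ] (P a)) ≡⟨ total-const _ (shuffle [ 1 ] (P a)) constˡ ⟩
      length (shuffle [ 1 ] (P a)) * ν                         ≡⟨ cong (_* ν) lengthˡ ⟩
      suc a * ν                                                ≡⟨ ℕ.*-comm (suc a) ν ⟩
      ν * suc a                                                ∎)
      where
      open ≡-Reasoning
      -- `g` marks the words in the fibre of `q` over `c`.
      g : List ℕ → ℕ
      g = indicator _≟ʷ_ c ∘ q

      ν : ℕ
      ν = total g (shuffle (1 ∷ P a) (R a))

      total-resp : ∀ {xs ys} → (xs , ys) ∈ comparisons a → total g xs ≡ total g ys
      total-resp {xs} {ys} i∈ = trans (sym (total-map (indicator _≟ʷ_ c) q xs))
        (trans (total-↭ (indicator _≟ʷ_ c) (q-↭ a<n i∈)) (total-map (indicator _≟ʷ_ c) q ys))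

      constʳ : ∀ {σ} → σ ∈ shuffle (P a) (R a) → total g (shuffle [ 1 ] σ) ≡ multiplicity c
      constʳ σ∈ = trans (total-resp (∈-++⁺ˡ (∈-map⁺ _ σ∈))) (sym (total-map (indicator _≟ʷ_ c) q insertions))

      constˡ : ∀ {π} → π ∈ shuffle [ 1 ] (P a) → total g (shuffle π (R a)) ≡ ν
      constˡ π∈ = total-resp (∈-++⁺ʳ (map _ (shuffle (P a) (R a))) (∈-map⁺ _ π∈))

      lengthʳ : length (shuffle (P a) (R a)) ≡ shuffleCount a (suc (N ∸ a))
      lengthʳ = trans (length-shuffle (P a) (R a))
        (cong₂ shuffleCount (length-interval 2 a) (length-interval (2 + a) (suc (N ∸ a))))

      lengthˡ : length (shuffle [ 1 ] (P a)) ≡ suc a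
      lengthˡ = trans (length-shuffle [ 1 ] (P a))
        (trans (cong (shuffleCount 1) (length-interval 2 a)) (shuffleCount-1 a))

    -- Take a + 1 = p ^ e in `multiplicity-∣`; the binomial coefficient is prime to p and cancels.
    -- Strictness of p ^ e < n gives a < N + 1, so both parts of the shuffle are shorter than n.
    prime-power-∣-multiplicity : ∀ c {p} → Prime p → ∀ e → p ^ e ∣ suc (suc N) → p ^ e < suc (suc N) →
      p ^ e ∣ multiplicity c
    prime-power-∣-multiplicity c {p} p-prime e p^e∣n p^e<n with p ^ e in eq
    ... | zero = contradiction eq (≢-nonZero⁻¹ (p ^ e) {{ℕ.m^n≢0 p e {{prime⇒nonZero p-prime}}}})
    ... | suc a = subst (_∣ multiplicity c) eq (prime^∣-cancelˡ p-prime
        (∤-shuffleCount p-prime e a (suc (N ∸ a))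
          (subst₂ _∣_ (sym eq) (sym a+b) p^e∣n) (subst (a <_) (sym eq) ≤-refl))
        e (subst (_∣ _) (sym eq) (multiplicity-∣ c (ℕ.≤-pred p^e<n))))
      where
      a+b : suc (a + suc (N ∸ a)) ≡ suc (suc N)
      a+b = cong suc (trans (ℕ.+-suc a (N ∸ a)) (cong suc (ℕ.m+[n∸m]≡n (ℕ.≤-pred (ℕ.≤-pred p^e<n)))))

    -- The shuffle set of the least letter of τ with its other letters has the same multiset of
    -- values as `insertions`.
    value-inserted : (τ : Perm (suc (suc N))) → ∃[ w ] w ∈ insertions × f (word τ) ≡ f w
    value-inserted τ with m , ρ , sep , τ∈ ← minimum-shuffle (word-isWord τ) =
      ∈-map⁻ f (↭.∈-resp-↭ (shuffle-values st compatible trivial refl sep σ₀-separated) (∈-map⁺ f τ∈))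

    -- If D divides every multiplicity then each class takes at least D of the n insertions.
    classes-bound : ∀ r D → .{{NonZero D}} → suc (suc N) ≡ r * D → (∀ c → D ∣ multiplicity c) →
      AtMostClassesOn (suc (suc N)) ≤-refl st r
    classes-bound r D n≡rD D∣ = mapMaybe (parse _) reps , few , covers
      where
      found = representatives _≟ʷ_ D (map q insertions)
        -- A member has positive multiplicity, so divisibility by D makes it at least D.
        λ c∈ → ∣⇒≤ {{>-nonZero (∈⇒0<count _≟ʷ_ c∈)}} (D∣ _)
      reps = proj₁ found

      length-insertions : length (map q insertions) ≡ suc (suc N)
      length-insertions = trans (length-map q insertions) (trans (length-shuffle [ 1 ] σ₀)
        (trans (shuffleCount-1 (length σ₀)) (cong suc (length-interval 2 (suc N)))))

      few : length (mapMaybe (parse _) reps) ≤ r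
      few = ℕ.≤-trans (length-mapMaybe (parse _) reps)
        (ℕ.*-cancelʳ-≤ (length reps) r D
          (subst (length reps * D ≤_) (trans length-insertions n≡rD) (proj₁ (proj₂ found))))

      covers : ∀ τ → Any (Equivalent st ≤-refl τ) (mapMaybe (parse _) reps)
      covers τ = let w , w∈ , fτ≡fw = value-inserted τ in
        Any.mapMaybe⁺ (parse _) reps (Any.map⁺
          (Any.map (λ { refl → represents fτ≡fw }) (proj₂ (proj₂ found) (∈-map⁺ q w∈))))
        where
        represents : ∀ {w} → f (word τ) ≡ f w → MaybeAny.Any (Equivalent st ≤-refl τ) (parse _ (q w))
        represents {w} fτ≡fw
          -- `f (q w)` is the value of τ and so a `just`; hence `q w` parses and survives
          -- `mapMaybe`.
          with parse (suc (suc N)) (q w) | trans (sym (wordValue-word st τ)) (trans fτ≡fw (sym (fq w)))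
        ... | just _ | eq = MaybeAny.just (just-injective eq)

  -- Here n = p * p ^ e, and the proper divisor p ^ e serves as D.
  prime-power-classes : ∀ {p} e → Prime p → suc (suc N) ≡ p ^ suc e → AtMostClassesOn (suc (suc N)) ≤-refl st p
  prime-power-classes {p} e p-prime n≡ = classes-bound p (p ^ e) {{p^e≢0}} n≡
    λ c → prime-power-∣-multiplicity c p-prime e (subst (p ^ e ∣_) (sym n≡) (n∣m*n p))
      (subst (p ^ e <_) (trans (ℕ.*-comm (p ^ e) p) (sym n≡))
        (ℕ.m<m*n (p ^ e) p {{p^e≢0}} (nonTrivial⇒n>1 p {{prime⇒nonTrivial p-prime}})))
    where
    p^e≢0 = ℕ.m^n≢0 p e {{prime⇒nonZero p-prime}}

  -- Every prime power dividing n is smaller than n and so divides each multiplicity. Hence n does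
  -- too, and one fibre takes up all n insertions.
  non-prime-power-trivial : ¬ PrimePower (suc (suc N)) → TrivialOn (suc (suc N)) ≤-refl st
  non-prime-power-trivial ¬pp = atMost1⇒trivial st
    (classes-bound 1 (suc (suc N)) (sym (ℕ.*-identityˡ _)) λ c → prime-powers-∣⇒∣ (suc (suc N)) (powers∣ c))
    where
    powers∣ : ∀ c p e → Prime p → p ^ e ∣ suc (suc N) → p ^ e ∣ multiplicity c
    powers∣ c p e p-prime p^e∣n = prime-power-∣-multiplicity c p-prime e p^e∣n
      (ℕ.≤∧≢⇒< (∣⇒≤ p^e∣n) (λ eq → ¬pp (proper e (sym eq))))
      where
      proper : ∀ e → suc (suc N) ≡ p ^ e → PrimePower (suc (suc N))
      -- The exponent is positive because n is at least 2.
      proper (suc e) eq = p , suc e , p-prime , s≤s z≤n , eq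

theorem4p11 : ∀ {a} {A : Set a} (n : ℕ) → 4 ≤ n →
    (st : Statistic A n) → WeaklyBicompatible st →
    Trivial (restrict (pred[n]≤n {n}) st) →
    (∀ p k → Prime p → 1 ≤ k → n ≡ p ^ k → AtMostClassesOn n ≤-refl st p)
    × (¬ PrimePower n → TrivialOn n ≤-refl st)
theorem4p11 1 (s≤s ())
theorem4p11 (suc (suc N)) _ st (compatible , _) trivial =
  (λ { p (suc e) p-prime _ n≡ → prime-power-classes st compatible trivial e p-prime n≡ })
  , non-prime-power-trivial st compatible trivial
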